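{- Let $G$ and $G_0$ be connected graphs such that $G$ is a cactus and $G_0$ is a subgraph of $G$ that is either a cactus or a cycle. Then there exist sequences $(P_1,\dots,P_r)$ and $(G_0,G_1,\dots,G_r)$ of subgraphs of $G$ ($r\ge 0$, with $r=0$ iff $G=G_0$) such that $G_r=G$, every $G_i$ with $i\ge1$ is a cactus, and for every $i\in\{1,\dots,r\}$: $G_i=G_{i-1}\cup P_i$ with $E(P_i)\cap E(G_{i-1})=\emptyset$, where $P_i$ is a path, a cycle, or a lollipop, and (p) if $P_i$ is a path then $V(G_{i-1})\cap V(P_i)=End(P_i)$; (l) if $P_i$ is a lollipop then $V(G_{i-1})\cap V(P_i)=End(P_i)$; (c) if $P_i$ is a cycle then $|V(G_{i-1})\cap V(P_i)|=1$. Consequently $G_{i-1}$ is a proper subgraph of $G_i$ and $\Delta G_i-\Delta G_{i-1}=1$ for all $i$.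
   Context: Graphs are finite, may have loops and parallel edges, and have no isolated vertices unless stated otherwise. A leaf is a vertex incident to exactly one edge, which is not a loop. $\Delta G=|E(G)|-|V(G)|$. A cycle is a connected graph all of whose vertices have degree 2 (a loop contributes 2; a single vertex with a loop is a cycle). An $(x,y)$-path is a path with distinct end vertices $x,y$ and at least one edge, and $End(P)=\{x,y\}$. A lollipop is a graph obtained from a cycle $C$ (possibly a loop) and a vertex-disjoint path $P$ with end vertices $y,x$ by identifying a vertex of $C$ with $y$; its end-vertex is $x$, and $End(Q)=\{x\}$. A cacti-graph is a graph with no isolated vertices, no leaves, and no component that is a cycle (equivalently, no isolated vertices, no leaves, and every component contains at least two cycles). A cactus is a connected cacti-graph (this is not the standard meaning of "cactus"). -}

module Defs where

open import Data.Nat using (ℕ; suc; _+_)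
open import Data.Integer using (ℤ; +_) renaming (_-_ to _-ℤ_)
open import Data.Fin using (Fin; zero; suc; inject₁; fromℕ; _≟_)
open import Data.Fin.Subset using (Subset; _∈_; _⊆_; _∩_; _∪_; ⊤; ⊥; ⁅_⁆; ∣_∣; Nonempty)
open import Data.Fin.Subset.Properties using (∈⊤; x∈p∪q⁻; x∈p∪q⁺)
open import Data.Vec using (tabulate)
open import Data.Product using (∃-syntax; _×_; _,_; proj₁; proj₂)
open import Data.Sum using (_⊎_; inj₁; inj₂; [_,_]′)
open import Function.Bundles using (_⇔_)
open import Function.Definitions using (Injective)
open import Relation.Binary.Construct.Closure.ReflexiveTransitive using (Star)
open import Relation.Binary.PropositionalEquality using (_≡_)
open import Relation.Nullary using (¬_; does)

-- Finite undirected multigraphs with loops. `source` and `target` list the two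
-- ends of an edge in an arbitrary order; every notion below is symmetric in them.
record Graph : Set where
  field
    #V #E         : ℕ
    source target : Fin #E → Fin #V

open Graph public

record Subgraph (G : Graph) : Set where
  field
    V      : Subset (#V G)
    E      : Subset (#E G)
    closed : ∀ {e} → e ∈ E → source G e ∈ V × target G e ∈ V

open Subgraph public

whole : (G : Graph) → Subgraph G
whole G = record { V = ⊤ ; E = ⊤ ; closed = λ _ → ∈⊤ , ∈⊤ }

module _ {G : Graph} where

  infix  4 _≈_ _⊑_ _⊏_
  infixr 6 _⊔_

  -- Equality of subgraphs (the `closed` proofs are not compared).
  _≈_ : Subgraph G → Subgraph G → Set
  H ≈ K = V H ≡ V K × E H ≡ E K

  _⊑_ : Subgraph G → Subgraph G → Set
  H ⊑ K = V H ⊆ V K × E H ⊆ E K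

  _⊏_ : Subgraph G → Subgraph G → Set
  H ⊏ K = H ⊑ K × ¬ (H ≈ K)

  _⊔_ : Subgraph G → Subgraph G → Subgraph G
  H ⊔ K = record
    { V      = V H ∪ V K
    ; E      = E H ∪ E K
    ; closed = λ e∈ → [ (λ p → x∈p∪q⁺ (inj₁ (proj₁ (closed H p))) , x∈p∪q⁺ (inj₁ (proj₂ (closed H p))))
                      , (λ p → x∈p∪q⁺ (inj₂ (proj₁ (closed K p))) , x∈p∪q⁺ (inj₂ (proj₂ (closed K p))))
                      ]′ (x∈p∪q⁻ (E H) (E K) e∈)
    }

  Joins : Fin (#E G) → Fin (#V G) → Fin (#V G) → Set
  Joins e u v = (source G e ≡ u × target G e ≡ v) ⊎ (source G e ≡ v × target G e ≡ u)

  Incident : Fin (#E G) → Fin (#V G) → Set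
  Incident e v = source G e ≡ v ⊎ target G e ≡ v

  IsLoop : Fin (#E G) → Set
  IsLoop e = source G e ≡ target G e

  Adjacent : Subgraph G → Fin (#V G) → Fin (#V G) → Set
  Adjacent H u v = ∃[ e ] e ∈ E H × Joins e u v

  -- The empty graph is not connected.
  Connected : Subgraph G → Set
  Connected H = Nonempty (V H) × (∀ {u v} → u ∈ V H → v ∈ V H → Star (Adjacent H) u v)

  -- A loop at v is counted once in each summand, hence twice.
  degree : Subgraph G → Fin (#V G) → ℕ
  degree H v = ∣ E H ∩ tabulate (λ e → does (source G e ≟ v)) ∣
             + ∣ E H ∩ tabulate (λ e → does (target G e ≟ v)) ∣

  Isolated : Subgraph G → Fin (#V G) → Set
  Isolated H v = v ∈ V H × (∀ {e} → e ∈ E H → ¬ Incident e v)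

  Leaf : Subgraph G → Fin (#V G) → Set
  Leaf H v = v ∈ V H ×
    (∃[ e ] e ∈ E H × Incident e v × ¬ IsLoop e × (∀ {f} → f ∈ E H → Incident f v → f ≡ e))

  IsComponent : Subgraph G → Subgraph G → Set
  IsComponent K H = K ⊑ H × Connected K × (∀ K′ → K ⊑ K′ → K′ ⊑ H → Connected K′ → K′ ⊑ K)

  IsCycle : Subgraph G → Set
  IsCycle C = Connected C × (∀ {v} → v ∈ V C → degree C v ≡ 2)

  IsCactiGraph : Subgraph G → Set
  IsCactiGraph H = (∀ v → ¬ Isolated H v) × (∀ v → ¬ Leaf H v) × (∀ K → IsComponent K H → ¬ IsCycle K)

  IsCactus : Subgraph G → Set
  IsCactus H = Connected H × IsCactiGraph H

  -- P consists of distinct vertices x = v₀ , … , v_{k+1} = y and edges e₀ , … , e_k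
  -- with eᵢ joining vᵢ and vᵢ₊₁; there is at least one edge, so x and y differ.
  record IsPath (P : Subgraph G) (x y : Fin (#V G)) : Set where
    field
      {k}      : ℕ
      vertex   : Fin (suc (suc k)) → Fin (#V G)
      edge     : Fin (suc k) → Fin (#E G)
      distinct : Injective _≡_ _≡_ vertex
      joins    : ∀ i → Joins (edge i) (vertex (inject₁ i)) (vertex (suc i))
      first    : vertex zero ≡ x
      last     : vertex (fromℕ (suc k)) ≡ y
      V-path   : ∀ v → v ∈ V P ⇔ (∃[ i ] vertex i ≡ v)
      E-path   : ∀ e → e ∈ E P ⇔ (∃[ i ] edge i ≡ e)

  -- Q is a lollipop with end-vertex x; as a subgraph of G, gluing the disjoint cycle
  -- and path at y means that C and P share exactly the vertex y and no edge.
  record IsLollipop (Q : Subgraph G) (x : Fin (#V G)) : Set where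
    field
      C P       : Subgraph G
      y         : Fin (#V G)
      cycle     : IsCycle C
      path      : IsPath P y x
      V-meet    : V C ∩ V P ≡ ⁅ y ⁆
      E-meet    : E C ∩ E P ≡ ⊥
      glued     : Q ≈ C ⊔ P

  record IsExtension (H P K : Subgraph G) : Set where
    field
      union         : K ≈ H ⊔ P
      edge-disjoint : E P ∩ E H ≡ ⊥
      shape         : (∃[ x ] ∃[ y ] IsPath P x y) ⊎ IsCycle P ⊎ (∃[ x ] IsLollipop P x)
      path-meet     : ∀ x y → IsPath P x y → V H ∩ V P ≡ ⁅ x ⁆ ∪ ⁅ y ⁆
      lollipop-meet : ∀ x → IsLollipop P x → V H ∩ V P ≡ ⁅ x ⁆
      cycle-meet    : IsCycle P → ∣ V H ∩ V P ∣ ≡ 1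

  -- P i and H (suc i) are the terms P_{i+1} and G_{i+1} of the two sequences.
  record IsDecomposition (G₀ : Subgraph G) (r : ℕ)
                         (P : Fin r → Subgraph G) (H : Fin (suc r) → Subgraph G) : Set where
    field
      starts   : H zero ≈ G₀
      ends     : H (fromℕ r) ≈ whole G
      trivial  : r ≡ 0 ⇔ whole G ≈ G₀
      cacti    : ∀ i → IsCactus (H (suc i))
      extends  : ∀ i → IsExtension (H (inject₁ i)) (P i) (H (suc i))

  Δ : Subgraph G → ℤ
  Δ H = + ∣ E H ∣ -ℤ + ∣ V H ∣

{-# OPTIONS --safe #-}
module Submission where

-- Let H be a connected subgraph with minimum degree at least 2, other than G. By connectedness
-- some edge f outside H has an end b in H. Walk from b along f; since G has no leaf, the walk can
-- leave every vertex outside H by an edge different from the one it came by, and none of its edges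
-- is in H. Stop as soon as it meets H or itself: it then traces a path, a cycle or a lollipop P,
-- H ∪ P has minimum degree at least 2 again, and b has degree at least 3 in it, so H ∪ P is a cactus.
-- As |E(P)| + |V(H) ∩ V(P)| = |V(P)| + 1 for all three shapes, Δ increases by exactly 1.

open import Defs
open import Data.Bool using (Bool; true; false; _∧_; _∨_)
open import Data.Nat using (ℕ; zero; suc; _+_; _*_; _≤_; z≤n; s≤s)
open import Data.Nat.Properties
  using (+-suc; +-comm; +-assoc; +-identityʳ; *-identityˡ; *-comm; *-distribʳ-+; *-distribˡ-+; *-cancelˡ-≡;
         +-cancelʳ-≡; suc-injective; ≤-reflexive; ≤-trans; m≤m+n; m≤n+m; +-mono-≤; +-*-semiring; module ≤-Reasoning)
open import Data.Nat.Tactic.RingSolver using (solve-∀)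
open import Data.Integer using (1ℤ; _-_) renaming (+_ to pos; _+_ to _+ℤ_)
import Data.Integer.Properties as ℤ
import Data.Integer.Tactic.RingSolver as ℤ-solve
open import Algebra.Properties.Semiring.Sum +-*-semiring
  using (sum-cong-≗; ∑-distrib-+; ∑-comm; *-distribˡ-sum; sum-replicate-zero; sum-syntax)
open import Data.Fin using (Fin; zero; suc; _≟_; inject₁; fromℕ)
import Data.Fin.Properties as Fin
open import Data.Fin.Properties using (any?)
open import Data.Fin.Subset
  using (Subset; _∈_; _∉_; _⊆_; _⊃_; _∩_; _∪_; ⊤; ⊥; ⁅_⁆; ∣_∣) renaming (_-_ to _∖_)
open import Data.Fin.Subset.Properties
open import Data.Fin.Subset.Induction using (⊃-wellFounded; Acc; acc)
open import Data.Vec using ([]; _∷_; lookup; tabulate; there)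
open import Data.Vec.Properties using ([]=⇒lookup; lookup⇒[]=; lookup-zipWith; lookup∘tabulate)
open import Data.Vec.Functional using () renaming (_∷_ to _◂_)
open import Data.Product using (∃-syntax; _×_; _,_; proj₁; proj₂)
import Data.Sum as Sum
open import Data.Sum using (_⊎_; inj₁; inj₂; [_,_]′)
open import Function using (_∘_; _∘′_; id)
open import Function.Bundles using (_⇔_; mk⇔; Equivalence)
open import Function.Definitions using (Injective)
open import Relation.Binary.Construct.Closure.ReflexiveTransitive
  using (Star; ε; _◅_; _◅◅_; reverse) renaming (map to mapStar)
open import Relation.Binary.PropositionalEquality
open import Relation.Nullary using (¬_; Dec; yes; no; does; contradiction)
open import Relation.Nullary.Decidable using (_×-dec_; _⊎-dec_; ¬?; decidable-stable)

-- Local information is carried by indicator functions `χ` with values in ℕ. A path from `x` to `y`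
-- then obeys `deg F v + χ ⁅ x ⁆ v + χ ⁅ y ⁆ v ≡ 2 * χ S v` at every vertex, with no distinction
-- between inner vertices, ends and vertices off the path; cycles and lollipops obey similar
-- identities. The obstacle lies in `IsExtension`: each meeting condition must hold for every way of
-- reading `P` as a path, a lollipop or a cycle, not just for the way it was built. The identities
-- settle this, since they locate the vertices of degree 1: `P` itself determines its shape and its
-- ends. The claims on `Δ` and on proper inclusion concern an arbitrary decomposition, so they are
-- derived from `IsExtension` alone.

private
  variable
    n : ℕ

-- Subsets, indicator functions and cardinalities

⇔⇒≡ : {p q : Subset n} → (∀ x → x ∈ p ⇔ x ∈ q) → p ≡ q
⇔⇒≡ h = ⊆-antisym (λ {x} → Equivalence.to (h x)) (λ {x} → Equivalence.from (h x))

⁅⁆⊆ : {x : Fin n} {p : Subset n} → x ∈ p → ⁅ x ⁆ ⊆ p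
⁅⁆⊆ {x = x} {p} x∈p y∈ = subst (_∈ p) (sym (x∈⁅y⁆⇒x≡y x y∈)) x∈p

⊆⇒∪≡ : {p q : Subset n} → p ⊆ q → p ∪ q ≡ q
⊆⇒∪≡ {p = p} {q} p⊆q = ⊆-antisym ([ p⊆q , id ]′ ∘′ x∈p∪q⁻ p q) (q⊆p∪q p q)

⟦_⟧ : Bool → ℕ
⟦ true ⟧  = 1
⟦ false ⟧ = 0

χ : Subset n → Fin n → ℕ
χ p x = ⟦ lookup p x ⟧

Disjoint : Subset n → Subset n → Set
Disjoint p q = ∀ {x} → x ∈ p → x ∉ q

∩≡⊥⇒Disjoint : {p q : Subset n} → p ∩ q ≡ ⊥ → Disjoint p q
∩≡⊥⇒Disjoint eq x∈p x∈q = ∉⊥ (subst (_ ∈_) eq (x∈p∩q⁺ (x∈p , x∈q)))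

Disjoint⇒∩≡⊥ : {p q : Subset n} → Disjoint p q → p ∩ q ≡ ⊥
Disjoint⇒∩≡⊥ {p = p} {q} d = Empty-unique λ (_ , x∈) → let x∈p , x∈q = x∈p∩q⁻ p q x∈ in d x∈p x∈q

∉⇒Disjoint-⁅⁆ : {x : Fin n} {p : Subset n} → x ∉ p → Disjoint ⁅ x ⁆ p
∉⇒Disjoint-⁅⁆ {x = x} x∉p y∈ rewrite x∈⁅y⁆⇒x≡y x y∈ = x∉p

χ-∈ : {p : Subset n} {x : Fin n} → x ∈ p → χ p x ≡ 1
χ-∈ x∈p = cong ⟦_⟧ ([]=⇒lookup x∈p)

χ-∉ : {p : Subset n} {x : Fin n} → x ∉ p → χ p x ≡ 0
χ-∉ {p = p} {x} x∉p with lookup p x in eq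
... | true  = contradiction (lookup⇒[]= x p eq) x∉p
... | false = refl

χ-≢ : {x y : Fin n} → y ≢ x → χ ⁅ x ⁆ y ≡ 0
χ-≢ = χ-∉ ∘ x≢y⇒x∉⁅y⁆

χ-≡ : (x : Fin n) → χ ⁅ x ⁆ x ≡ 1
χ-≡ x = χ-∈ (x∈⁅x⁆ x)

χ-⊥ : (x : Fin n) → χ ⊥ x ≡ 0
χ-⊥ x = χ-∉ {p = ⊥} {x} ∉⊥

-- Inclusion-exclusion at a single point, kept additive to avoid truncated subtraction; its sum over
-- all points is `∣∪∣+∣∩∣`.
χ-∪∩ : (p q : Subset n) (x : Fin n) → χ (p ∪ q) x + χ (p ∩ q) x ≡ χ p x + χ q x
χ-∪∩ p q x rewrite lookup-zipWith _∨_ x p q | lookup-zipWith _∧_ x p q with lookup p x | lookup q x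
... | true  | true  = refl
... | true  | false = refl
... | false | true  = refl
... | false | false = refl

χ-⊎ : {p q : Subset n} → Disjoint p q → ∀ x → χ (p ∪ q) x ≡ χ p x + χ q x
χ-⊎ {p = p} {q} d x = begin
  χ (p ∪ q) x               ≡⟨ +-identityʳ _ ⟨
  χ (p ∪ q) x + 0           ≡⟨ cong (χ (p ∪ q) x +_) (trans (cong (λ r → χ r x) (Disjoint⇒∩≡⊥ d)) (χ-⊥ x)) ⟨
  χ (p ∪ q) x + χ (p ∩ q) x ≡⟨ χ-∪∩ p q x ⟩
  χ p x + χ q x             ∎
  where open ≡-Reasoning

∣∣≡∑χ : (p : Subset n) → ∣ p ∣ ≡ ∑[ x < n ] χ p x
∣∣≡∑χ []          = refl
∣∣≡∑χ (true  ∷ p) = cong suc (∣∣≡∑χ p)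
∣∣≡∑χ (false ∷ p) = ∣∣≡∑χ p

∑χ⁅⁆ : (a : Fin n) → ∑[ x < n ] χ ⁅ a ⁆ x ≡ 1
∑χ⁅⁆ a = trans (sym (∣∣≡∑χ ⁅ a ⁆)) (∣⁅x⁆∣≡1 a)

∑χ⁅⁆* : (a : Fin n) (f : Fin n → ℕ) → ∑[ x < n ] (χ ⁅ a ⁆ x * f x) ≡ f a
∑χ⁅⁆* {suc n} zero f = trans (cong₂ _+_ (*-identityˡ (f zero)) (trans (sum-cong-≗ {n} λ i → cong (_* f (suc i)) (χ-⊥ i)) (sum-replicate-zero n)))
                             (+-identityʳ _)
∑χ⁅⁆* (suc a) f = ∑χ⁅⁆* a (f ∘ suc)

∣∪∣+∣∩∣ : (p q : Subset n) → ∣ p ∪ q ∣ + ∣ p ∩ q ∣ ≡ ∣ p ∣ + ∣ q ∣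
∣∪∣+∣∩∣ {n} p q = begin
  ∣ p ∪ q ∣ + ∣ p ∩ q ∣                             ≡⟨ cong₂ _+_ (∣∣≡∑χ (p ∪ q)) (∣∣≡∑χ (p ∩ q)) ⟩
  ∑[ x < n ] χ (p ∪ q) x + ∑[ x < n ] χ (p ∩ q) x   ≡⟨ ∑-distrib-+ (χ (p ∪ q)) (χ (p ∩ q)) ⟨
  ∑[ x < n ] (χ (p ∪ q) x + χ (p ∩ q) x)            ≡⟨ sum-cong-≗ (χ-∪∩ p q) ⟩
  ∑[ x < n ] (χ p x + χ q x)                        ≡⟨ ∑-distrib-+ (χ p) (χ q) ⟩
  ∑[ x < n ] χ p x + ∑[ x < n ] χ q x               ≡⟨ cong₂ _+_ (∣∣≡∑χ p) (∣∣≡∑χ q) ⟨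
  ∣ p ∣ + ∣ q ∣                                     ∎
  where open ≡-Reasoning

∣⊎∣ : {p q : Subset n} → Disjoint p q → ∣ p ∪ q ∣ ≡ ∣ p ∣ + ∣ q ∣
∣⊎∣ {n} {p} {q} d = begin
  ∣ p ∪ q ∣             ≡⟨ +-identityʳ _ ⟨
  ∣ p ∪ q ∣ + 0         ≡⟨ cong (∣ p ∪ q ∣ +_) (trans (cong ∣_∣ (Disjoint⇒∩≡⊥ d)) (∣⊥∣≡0 n)) ⟨
  ∣ p ∪ q ∣ + ∣ p ∩ q ∣ ≡⟨ ∣∪∣+∣∩∣ p q ⟩
  ∣ p ∣ + ∣ q ∣         ∎
  where open ≡-Reasoning

∣⁅⁆∪∣ : {x : Fin n} {p : Subset n} → x ∉ p → ∣ ⁅ x ⁆ ∪ p ∣ ≡ suc ∣ p ∣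
∣⁅⁆∪∣ {x = x} {p} x∉p = trans (∣⊎∣ (∉⇒Disjoint-⁅⁆ x∉p)) (cong (_+ ∣ p ∣) (∣⁅x⁆∣≡1 x))

⁅⁆∪-remove : {x : Fin n} {p : Subset n} → x ∈ p → ⁅ x ⁆ ∪ (p ∖ x) ≡ p
⁅⁆∪-remove {x = x} {p} x∈p = ⊆-antisym
  ([ ⁅⁆⊆ x∈p , p─q⊆p p ⁅ x ⁆ ]′ ∘′ x∈p∪q⁻ ⁅ x ⁆ (p ∖ x))
  λ {y} y∈p → x∈p∪q⁺ (case y y∈p)
  where
  case : ∀ y → y ∈ p → y ∈ ⁅ x ⁆ ⊎ y ∈ p ∖ x
  case y y∈p with y ≟ x
  ... | yes refl = inj₁ (x∈⁅x⁆ x)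
  ... | no y≢x   = inj₂ (x∈p∧x≢y⇒x∈p-y y∈p y≢x)

x∉p∖x : (p : Subset n) (x : Fin n) → x ∉ p ∖ x
x∉p∖x (_ ∷ p) (suc x) (there x∈) = x∉p∖x p x x∈

-- Degrees as sums over edges

module Degree (G : Graph) where

  Vertex Edge : Set
  Vertex = Fin (#V G)
  Edge   = Fin (#E G)

  -- The entry of the incidence matrix, equal to 2 for a loop at `v`.
  inc : Edge → Vertex → ℕ
  inc e v = χ ⁅ source G e ⁆ v + χ ⁅ target G e ⁆ v

  deg : Subset (#E G) → Vertex → ℕ
  deg F v = ∑[ e < #E G ] (χ F e * inc e v)

  private
    χ-∩-tabulate : (F : Subset n) (f : Fin n → Bool) → ∀ e → χ (F ∩ tabulate f) e ≡ χ F e * ⟦ f e ⟧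
    χ-∩-tabulate F f e rewrite lookup-zipWith _∧_ e F (tabulate f) | lookup∘tabulate f e with lookup F e
    ... | true  = sym (+-identityʳ _)
    ... | false = refl

    ⟦≟⟧ : (u v : Fin n) → ⟦ does (u ≟ v) ⟧ ≡ χ ⁅ u ⁆ v
    ⟦≟⟧ u v with u ≟ v
    ... | yes refl = sym (χ-≡ u)
    ... | no u≢v   = sym (χ-≢ (u≢v ∘ sym))

    ∣∩tabulate≟∣ : (F : Subset (#E G)) (s : Edge → Vertex) (v : Vertex) →
      ∣ F ∩ tabulate (λ e → does (s e ≟ v)) ∣ ≡ ∑[ e < #E G ] (χ F e * χ ⁅ s e ⁆ v)
    ∣∩tabulate≟∣ F s v = trans (∣∣≡∑χ (F ∩ tabulate at-v))
      (sum-cong-≗ λ e → trans (χ-∩-tabulate F at-v e) (cong (χ F e *_) (⟦≟⟧ (s e) v)))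
      where
      at-v : Edge → Bool
      at-v e = does (s e ≟ v)

  degree≡deg : (H : Subgraph G) (v : Vertex) → degree H v ≡ deg (E H) v
  degree≡deg H v = begin
    degree H v ≡⟨ cong₂ _+_ (∣∩tabulate≟∣ (E H) (source G) v) (∣∩tabulate≟∣ (E H) (target G) v) ⟩
    _          ≡⟨ ∑-distrib-+ (λ e → χ (E H) e * χ ⁅ source G e ⁆ v) (λ e → χ (E H) e * χ ⁅ target G e ⁆ v) ⟨
    _          ≡⟨ sum-cong-≗ (λ e → sym (*-distribˡ-+ (χ (E H) e) _ _)) ⟩
    deg (E H) v ∎
    where open ≡-Reasoning

  deg-⊎ : {F F′ : Subset (#E G)} → Disjoint F F′ → ∀ v → deg (F ∪ F′) v ≡ deg F v + deg F′ v
  deg-⊎ {F} {F′} d v = trans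
    (sum-cong-≗ λ e → trans (cong (_* inc e v) (χ-⊎ d e)) (*-distribʳ-+ (inc e v) (χ F e) _))
    (∑-distrib-+ (λ e → χ F e * inc e v) (λ e → χ F′ e * inc e v))

  deg-⊥ : ∀ v → deg ⊥ v ≡ 0
  deg-⊥ v = trans (sum-cong-≗ λ e → cong (_* inc e v) (χ-⊥ e)) (sum-replicate-zero (#E G))

  deg-⁅⁆∪ : {e : Edge} {F : Subset (#E G)} → e ∉ F → ∀ v → deg (⁅ e ⁆ ∪ F) v ≡ inc e v + deg F v
  deg-⁅⁆∪ {e} {F} e∉F v = trans (deg-⊎ (∉⇒Disjoint-⁅⁆ e∉F) v) (cong (_+ deg F v) (∑χ⁅⁆* e (λ e → inc e v)))

  deg-remove : {e : Edge} {F : Subset (#E G)} → e ∈ F → ∀ v → deg F v ≡ inc e v + deg (F ∖ e) v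
  deg-remove {e} {F} e∈F v = trans (cong (λ F → deg F v) (sym (⁅⁆∪-remove e∈F))) (deg-⁅⁆∪ (x∉p∖x F e) v)

  ¬Incident⇒inc≡0 : ∀ {e v} → ¬ Incident {G} e v → inc e v ≡ 0
  ¬Incident⇒inc≡0 ¬i = cong₂ _+_ (χ-≢ (¬i ∘ inj₁ ∘ sym)) (χ-≢ (¬i ∘ inj₂ ∘ sym))

  Incident⇒1≤inc : ∀ {e v} → Incident {G} e v → 1 ≤ inc e v
  Incident⇒1≤inc {e} (inj₁ refl) rewrite χ-≡ (source G e) = s≤s z≤n
  Incident⇒1≤inc {e} (inj₂ refl) rewrite χ-≡ (target G e) = m≤n+m 1 _

  deg-unincident : ∀ {F v} → (∀ {e} → e ∈ F → ¬ Incident {G} e v) → deg F v ≡ 0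
  deg-unincident {F} {v} h = trans (sum-cong-≗ term) (sum-replicate-zero (#E G))
    where
    term : ∀ e → χ F e * inc e v ≡ 0
    term e with e ∈? F
    ... | yes e∈F rewrite ¬Incident⇒inc≡0 (h e∈F) = *-comm (χ F e) 0
    ... | no e∉F rewrite χ-∉ e∉F = refl

  -- Double counting: once the sums are exchanged, each edge of `F` contributes its column sum of
  -- `inc`, which is 2 for loops as well.
  handshake : ∀ F → ∑[ v < #V G ] deg F v ≡ 2 * ∣ F ∣
  handshake F = begin
    ∑[ v < #V G ] deg F v                                   ≡⟨ ∑-comm (λ v e → χ F e * inc e v) ⟩
    ∑[ e < #E G ] ∑[ v < #V G ] (χ F e * inc e v)           ≡⟨ sum-cong-≗ (λ e → sym (*-distribˡ-sum (χ F e) (inc e))) ⟩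
    ∑[ e < #E G ] (χ F e * ∑[ v < #V G ] inc e v)           ≡⟨ sum-cong-≗ (λ e → trans (cong (χ F e *_) (∑inc e)) (*-comm (χ F e) 2)) ⟩
    ∑[ e < #E G ] (2 * χ F e)                               ≡⟨ *-distribˡ-sum 2 (χ F) ⟨
    2 * ∑[ e < #E G ] χ F e                                 ≡⟨ cong (2 *_) (∣∣≡∑χ F) ⟨
    2 * ∣ F ∣                                               ∎
    where
    open ≡-Reasoning
    ∑inc : ∀ e → ∑[ v < #V G ] inc e v ≡ 2
    ∑inc e = trans (∑-distrib-+ (χ ⁅ source G e ⁆) (χ ⁅ target G e ⁆)) (cong₂ _+_ (∑χ⁅⁆ (source G e)) (∑χ⁅⁆ (target G e)))

-- Inductive paths and their equivalence with listed paths

module Paths (G : Graph) where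

  open Degree G public

  Joins-sym : ∀ {e u v} → Joins {G} e u v → Joins {G} e v u
  Joins-sym (inj₁ j) = inj₂ j
  Joins-sym (inj₂ j) = inj₁ j

  Joins-inc : ∀ {e u v} → Joins {G} e u v → ∀ w → inc e w ≡ χ ⁅ u ⁆ w + χ ⁅ v ⁆ w
  Joins-inc (inj₁ (refl , refl)) w = refl
  Joins-inc {e} (inj₂ (refl , refl)) w = +-comm (χ ⁅ source G e ⁆ w) _

  Joins-ends : ∀ {e u v} {S : Subset (#V G)} → Joins {G} e u v → u ∈ S → v ∈ S → source G e ∈ S × target G e ∈ S
  Joins-ends (inj₁ (refl , refl)) u∈ v∈ = u∈ , v∈
  Joins-ends (inj₂ (refl , refl)) u∈ v∈ = v∈ , u∈

  Joins-end∈ : ∀ {e u v} {S : Subset (#V G)} → Joins {G} e u v → source G e ∈ S × target G e ∈ S → u ∈ S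
  Joins-end∈ (inj₁ (refl , refl)) (s∈ , _) = s∈
  Joins-end∈ (inj₂ (refl , refl)) (_ , t∈) = t∈

  -- The indices are the two ends, the vertex set and the edge set.
  data Path : (x y : Vertex) → Subset (#V G) → Subset (#E G) → Set where
    []   : ∀ {x} → Path x x ⁅ x ⁆ ⊥
    step : ∀ {e x z y S F} → Joins {G} e x z → x ∉ S → Path z y S F → Path x y (⁅ x ⁆ ∪ S) (⁅ e ⁆ ∪ F)

  source∈ : ∀ {x y S F} → Path x y S F → x ∈ S
  source∈ []             = x∈⁅x⁆ _
  source∈ (step {S = S} _ _ _) = p⊆p∪q S (x∈⁅x⁆ _)

  target∈ : ∀ {x y S F} → Path x y S F → y ∈ S
  target∈ []                             = x∈⁅x⁆ _
  target∈ (step {x = x} {S = S} _ _ p)   = q⊆p∪q ⁅ x ⁆ S (target∈ p)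

  path-closed : ∀ {x y S F} → Path x y S F → ∀ {e} → e ∈ F → source G e ∈ S × target G e ∈ S
  path-closed [] e∈ = contradiction e∈ ∉⊥
  path-closed (step {f} {x} {z} {S = S} {F} j x∉ p) {e} e∈ with x∈p∪q⁻ ⁅ f ⁆ F e∈
  ... | inj₂ e∈F = let s∈ , t∈ = path-closed p e∈F in q⊆p∪q ⁅ x ⁆ S s∈ , q⊆p∪q ⁅ x ⁆ S t∈
  ... | inj₁ e≡f rewrite x∈⁅y⁆⇒x≡y f e≡f = Joins-ends j (p⊆p∪q S (x∈⁅x⁆ x)) (q⊆p∪q ⁅ x ⁆ S (source∈ p))

  -- Both ends of an edge of a path lie on the path. Thus the distinct vertices in `step` already
  -- force distinct edges.
  fresh-edge : ∀ {x y u v S F e} → Path x y S F → Joins {G} e u v → u ∉ S → e ∉ F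
  fresh-edge p j u∉S e∈F = u∉S (Joins-end∈ j (path-closed p e∈F))

  private
    step-arith : ∀ a z d y s → d + z + y ≡ 2 * s → (a + z + d) + a + y ≡ 2 * (a + s)
    step-arith a z d y s eq = begin
      (a + z + d) + a + y ≡⟨ lhs a z d y ⟩
      2 * a + (d + z + y) ≡⟨ cong (2 * a +_) eq ⟩
      2 * a + 2 * s       ≡⟨ *-distribˡ-+ 2 a s ⟨
      2 * (a + s)         ∎
      where
      open ≡-Reasoning
      lhs : ∀ a z d y → (a + z + d) + a + y ≡ 2 * a + (d + z + y)
      lhs = solve-∀

  -- An inner vertex has degree 2; an end has degree 1, which its indicator raises to 2. In the
  -- empty path both indicators fall on one vertex of degree 0, so the induction can start there.
  path-deg : ∀ {x y S F} → Path x y S F → ∀ v → deg F v + χ ⁅ x ⁆ v + χ ⁅ y ⁆ v ≡ 2 * χ S v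
  path-deg ([] {x}) v rewrite deg-⊥ v = cong (χ ⁅ x ⁆ v +_) (sym (+-identityʳ _))
  path-deg (step {e} {x} {z} {y} {S} {F} j x∉S p) v
    rewrite deg-⁅⁆∪ (fresh-edge p j x∉S) v | Joins-inc j v | χ-⊎ (∉⇒Disjoint-⁅⁆ x∉S) v
    = step-arith (χ ⁅ x ⁆ v) (χ ⁅ z ⁆ v) (deg F v) (χ ⁅ y ⁆ v) (χ S v) (path-deg p v)

  path-card : ∀ {x y S F} → Path x y S F → suc ∣ F ∣ ≡ ∣ S ∣
  path-card ([] {x}) = trans (cong suc (∣⊥∣≡0 (#E G))) (sym (∣⁅x⁆∣≡1 x))
  path-card (step j x∉S p) rewrite ∣⁅⁆∪∣ (fresh-edge p j x∉S) | ∣⁅⁆∪∣ x∉S = cong suc (path-card p)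

  Adj : Subset (#E G) → Vertex → Vertex → Set
  Adj F u v = ∃[ e ] e ∈ F × Joins {G} e u v

  Adj-mono : ∀ {F F′} → F ⊆ F′ → ∀ {u v} → Star (Adj F) u v → Star (Adj F′) u v
  Adj-mono F⊆F′ = mapStar λ (e , e∈ , j) → e , F⊆F′ e∈ , j

  Adj-sym : ∀ {F u v} → Star (Adj F) u v → Star (Adj F) v u
  Adj-sym = reverse λ (e , e∈ , j) → e , e∈ , Joins-sym j

  connected-via : (H : Subgraph G) {b : Vertex} → b ∈ V H → (∀ {v} → v ∈ V H → Star (Adj (E H)) v b) → Connected H
  connected-via H {b} b∈ h = (b , b∈) , λ u∈ v∈ → h u∈ ◅◅ Adj-sym (h v∈)

  path-connected : ∀ {x y S F} → Path x y S F → ∀ {v} → v ∈ S → Star (Adj F) v y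
  path-connected ([] {x}) v∈ rewrite x∈⁅y⁆⇒x≡y x v∈ = ε
  path-connected (step {e} {x} {S = S} {F} j x∉S p) v∈ with x∈p∪q⁻ ⁅ x ⁆ S v∈
  ... | inj₂ v∈S = Adj-mono (q⊆p∪q ⁅ e ⁆ F) (path-connected p v∈S)
  ... | inj₁ v≡x rewrite x∈⁅y⁆⇒x≡y x v≡x =
    (e , p⊆p∪q F (x∈⁅x⁆ e) , j) ◅ Adj-mono (q⊆p∪q ⁅ e ⁆ F) (path-connected p (source∈ p))

  -- A path cut at `w`; it serves to separate the cycle of a lollipop from its stick.
  record Split (x w y : Vertex) (S : Subset (#V G)) (F : Subset (#E G)) : Set where
    field
      {S₁ S₂}  : Subset (#V G)
      {F₁ F₂}  : Subset (#E G)
      before   : Path x w S₁ F₁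
      after    : Path w y S₂ F₂
      S-union  : S ≡ S₁ ∪ S₂
      F-union  : F ≡ F₁ ∪ F₂
      S-meet   : ∀ {v} → v ∈ S₁ → v ∈ S₂ → v ≡ w
      F-meet   : Disjoint F₁ F₂

  split : ∀ {x w y S F} → Path x y S F → w ∈ S → Split x w y S F
  split {x} {w} p w∈ with w ≟ x
  split {x} {w} p w∈ | yes refl = record
    { before  = []
    ; after   = p
    ; S-union = sym (⊆⇒∪≡ (⁅⁆⊆ (source∈ p)))
    ; F-union = sym (∪-identityˡ _)
    ; S-meet  = λ v∈ _ → x∈⁅y⁆⇒x≡y x v∈
    ; F-meet  = λ e∈ → contradiction e∈ ∉⊥
    }
  split {x} [] w∈ | no w≢x = contradiction (x∈⁅y⁆⇒x≡y x w∈) w≢x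
  split {x} {w} (step {e} {S = S} {F} j x∉S p) w∈ | no w≢x = record
    { before  = step j (x∉S ∘ S₁⊆S) before
    ; after   = after
    ; S-union = trans (cong (⁅ x ⁆ ∪_) S-union) (sym (∪-assoc ⁅ x ⁆ S₁ S₂))
    ; F-union = trans (cong (⁅ e ⁆ ∪_) F-union) (sym (∪-assoc ⁅ e ⁆ F₁ F₂))
    ; S-meet  = λ v∈ v∈S₂ → [ (λ v≡x → contradiction (S₂⊆S (subst (_∈ S₂) (x∈⁅y⁆⇒x≡y x v≡x) v∈S₂)) x∉S)
                            , (λ v∈S₁ → S-meet v∈S₁ v∈S₂) ]′ (x∈p∪q⁻ ⁅ x ⁆ S₁ v∈)
    ; F-meet  = λ f∈ f∈F₂ → [ (λ f≡e → e∉F (F₂⊆F (subst (_∈ F₂) (x∈⁅y⁆⇒x≡y e f≡e) f∈F₂)))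
                            , (λ f∈F₁ → F-meet f∈F₁ f∈F₂) ]′ (x∈p∪q⁻ ⁅ e ⁆ F₁ f∈)
    }
    where
    w∈S : w ∈ S
    w∈S = [ (λ w≡x → contradiction (x∈⁅y⁆⇒x≡y x w≡x) w≢x) , id ]′ (x∈p∪q⁻ ⁅ x ⁆ S w∈)
    open Split (split p w∈S)
    S₁⊆S : S₁ ⊆ S
    S₁⊆S v∈ = subst (_ ∈_) (sym S-union) (p⊆p∪q S₂ v∈)
    S₂⊆S : S₂ ⊆ S
    S₂⊆S v∈ = subst (_ ∈_) (sym S-union) (q⊆p∪q S₁ S₂ v∈)
    F₂⊆F : F₂ ⊆ F
    F₂⊆F v∈ = subst (_ ∈_) (sym F-union) (q⊆p∪q F₁ F₂ v∈)
    e∉F : e ∉ F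
    e∉F = fresh-edge p j x∉S

  -- The data of `IsPath`, with the empty path allowed.
  record Listing (k : ℕ) (x y : Vertex) (S : Subset (#V G)) (F : Subset (#E G)) : Set where
    field
      vertex   : Fin (suc k) → Vertex
      edge     : Fin k → Edge
      distinct : Injective _≡_ _≡_ vertex
      joins    : ∀ i → Joins {G} (edge i) (vertex (inject₁ i)) (vertex (suc i))
      first    : vertex zero ≡ x
      last     : vertex (fromℕ k) ≡ y
      V-path   : ∀ v → v ∈ S ⇔ (∃[ i ] vertex i ≡ v)
      E-path   : ∀ e → e ∈ F ⇔ (∃[ i ] edge i ≡ e)

  ∈-⁅⁆∪-listed : ∀ {n k} (f : Fin (suc k) → Fin n) {S} → (∀ v → v ∈ S ⇔ (∃[ i ] f (suc i) ≡ v)) →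
    ∀ v → v ∈ ⁅ f zero ⁆ ∪ S ⇔ (∃[ i ] f i ≡ v)
  ∈-⁅⁆∪-listed f {S} h v = mk⇔ to from
    where
    to : v ∈ ⁅ f zero ⁆ ∪ S → ∃[ i ] f i ≡ v
    to v∈ with x∈p∪q⁻ ⁅ f zero ⁆ S v∈
    ... | inj₁ v≡x = zero , sym (x∈⁅y⁆⇒x≡y (f zero) v≡x)
    ... | inj₂ v∈S = let i , eq = Equivalence.to (h v) v∈S in suc i , eq
    from : ∃[ i ] f i ≡ v → v ∈ ⁅ f zero ⁆ ∪ S
    from (zero , refl) = p⊆p∪q S (x∈⁅x⁆ (f zero))
    from (suc i , eq)  = q⊆p∪q ⁅ f zero ⁆ S (Equivalence.from (h v) (i , eq))

  listing : ∀ {x y S F} → Path x y S F → ∃[ k ] Listing k x y S F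
  listing ([] {x}) = 0 , record
    { vertex   = λ _ → x
    ; edge     = λ ()
    ; distinct = λ { {zero} {zero} _ → refl }
    ; joins    = λ ()
    ; first    = refl
    ; last     = refl
    ; V-path   = λ v → mk⇔ (λ v∈ → zero , sym (x∈⁅y⁆⇒x≡y x v∈)) λ { (_ , refl) → x∈⁅x⁆ x }
    ; E-path   = λ e → mk⇔ (λ e∈ → contradiction e∈ ∉⊥) λ ()
    }
  listing (step {e} {x} j x∉S p) with listing p
  ... | k , l = suc k , record
    { vertex   = x ◂ vertex
    ; edge     = e ◂ edge
    ; distinct = λ { {zero}  {zero}  _  → refl
                   ; {zero}  {suc b} eq → contradiction (Equivalence.from (V-path x) (b , sym eq)) x∉S
                   ; {suc a} {zero}  eq → contradiction (Equivalence.from (V-path x) (a , eq)) x∉S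
                   ; {suc a} {suc b} eq → cong suc (distinct eq) }
    ; joins    = λ { zero → subst (Joins {G} e x) (sym first) j ; (suc i) → joins i }
    ; first    = refl
    ; last     = last
    ; V-path   = ∈-⁅⁆∪-listed (x ◂ vertex) V-path
    ; E-path   = ∈-⁅⁆∪-listed (e ◂ edge) E-path
    }
    where open Listing l

  -- `Path` has its exact vertex and edge sets as indices, whereas `Listing` only characterises
  -- membership. The tail therefore gets the images of the shifted functions as its sets, and
  -- extensionality of subsets carries the result back.
  unlisting : ∀ {k x y S F} → Listing k x y S F → Path x y S F
  unlisting {zero} {x} {y} l = subst₂ (Path x y) (sym S≡) (sym F≡) (subst (λ z → Path x z ⁅ x ⁆ ⊥) (trans (sym first) last) [])
    where
    open Listing l
    S≡ : _ ≡ ⁅ x ⁆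
    S≡ = ⇔⇒≡ λ v → mk⇔
      (λ v∈ → case (Equivalence.to (V-path v) v∈))
      λ v∈ → Equivalence.from (V-path v) (zero , trans first (sym (x∈⁅y⁆⇒x≡y x v∈)))
      where
      case : ∀ {v} → ∃[ i ] vertex i ≡ v → v ∈ ⁅ x ⁆
      case (zero , refl) = subst (_∈ ⁅ x ⁆) (sym first) (x∈⁅x⁆ x)
    F≡ : _ ≡ ⊥
    F≡ = Empty-unique λ (e , e∈) → Fin.¬Fin0 (proj₁ (Equivalence.to (E-path e) e∈))
  unlisting {suc k} {x} {y} {S} {F} l = subst₂ (Path x y) (sym S≡) (sym F≡)
    (subst (λ z → Path z y (⁅ vertex zero ⁆ ∪ image (vertex ∘ suc)) (⁅ edge zero ⁆ ∪ image (edge ∘ suc))) first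
      (step (joins zero) vertex₀∉ (unlisting tail)))
    where
    open Listing l
    image : ∀ {k n} → (Fin k → Fin n) → Subset n
    image {zero}  f = ⊥
    image {suc k} f = ⁅ f zero ⁆ ∪ image (f ∘ suc)
    ∈-image : ∀ {k n} (f : Fin k → Fin n) v → v ∈ image f ⇔ (∃[ i ] f i ≡ v)
    ∈-image {zero}  f v = mk⇔ (λ v∈ → contradiction v∈ ∉⊥) λ ()
    ∈-image {suc k} f v = ∈-⁅⁆∪-listed f (∈-image (f ∘ suc)) v
    S≡ : S ≡ image vertex
    S≡ = ⇔⇒≡ λ v → mk⇔ (Equivalence.from (∈-image vertex v) ∘ Equivalence.to (V-path v))
                       (Equivalence.from (V-path v) ∘ Equivalence.to (∈-image vertex v))
    F≡ : F ≡ image edge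
    F≡ = ⇔⇒≡ λ e → mk⇔ (Equivalence.from (∈-image edge e) ∘ Equivalence.to (E-path e))
                       (Equivalence.from (E-path e) ∘ Equivalence.to (∈-image edge e))
    vertex₀∉ : vertex zero ∉ image (vertex ∘ suc)
    vertex₀∉ v∈ with Equivalence.to (∈-image (vertex ∘ suc) _) v∈
    ... | i , eq with () ← distinct {suc i} {zero} eq
    tail : Listing k (vertex (suc zero)) y (image (vertex ∘ suc)) (image (edge ∘ suc))
    tail = record
      { vertex = vertex ∘ suc ; edge = edge ∘ suc ; distinct = Fin.suc-injective ∘ distinct
      ; joins = joins ∘ suc ; first = refl ; last = last
      ; V-path = ∈-image (vertex ∘ suc) ; E-path = ∈-image (edge ∘ suc) }

  isPath⇒path : ∀ {P x y} → IsPath {G} P x y → Path x y (V P) (E P)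
  isPath⇒path p = unlisting record { IsPath p }

  isPath⇒≢ : ∀ {P x y} → IsPath {G} P x y → x ≢ y
  isPath⇒≢ p x≡y with () ← IsPath.distinct p {zero} (trans (IsPath.first p) (trans x≡y (sym (IsPath.last p))))

  path⇒isPath : ∀ {P x y} → Path x y (V P) (E P) → x ≢ y → IsPath {G} P x y
  path⇒isPath p x≢y with listing p
  ... | zero  , l = contradiction (trans (sym (Listing.first l)) (Listing.last l)) x≢y
  ... | suc k , l = record { Listing l }

-- Degrees, ends and counts for paths, cycles and lollipops

module Ears (G : Graph) where

  open Paths G public

  isPath-deg : ∀ {P x y} → IsPath {G} P x y → ∀ v → deg (E P) v + χ ⁅ x ⁆ v + χ ⁅ y ⁆ v ≡ 2 * χ (V P) v
  isPath-deg = path-deg ∘ isPath⇒path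

  -- On `C` this is the definition; off `C` no edge of `C` is incident to `v`, because `C` is
  -- closed. Being valid at every vertex of `G`, it can be summed.
  cycle-deg : ∀ {C} → IsCycle {G} C → ∀ v → deg (E C) v ≡ 2 * χ (V C) v
  cycle-deg {C} (_ , two) v with v ∈? V C
  ... | yes v∈ rewrite χ-∈ v∈ = trans (sym (degree≡deg C v)) (two v∈)
  ... | no v∉  rewrite χ-∉ v∉ = deg-unincident {E C} λ
    { e∈ (inj₁ refl) → v∉ (proj₁ (closed C e∈)) ; e∈ (inj₂ refl) → v∉ (proj₂ (closed C e∈)) }

  lollipop-≢ : ∀ {Q x} (l : IsLollipop {G} Q x) → x ≢ IsLollipop.y l
  lollipop-≢ l = isPath⇒≢ (IsLollipop.path l) ∘ sym

  -- The identities of the cycle and the path are added. The shared vertex `y` is counted in both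
  -- and ends up with degree 2 + 1 = 3, while `x` has degree 1.
  lollipop-deg : ∀ {Q x} (l : IsLollipop {G} Q x) → ∀ v → deg (E Q) v + χ ⁅ x ⁆ v ≡ 2 * χ (V Q) v + χ ⁅ IsLollipop.y l ⁆ v
  lollipop-deg {Q} {x} l v
    rewrite proj₁ (IsLollipop.glued l) | proj₂ (IsLollipop.glued l) | deg-⊎ (∩≡⊥⇒Disjoint (IsLollipop.E-meet l)) v
    = +-cancelʳ-≡ (χ ⁅ y ⁆ v) _ _ (begin
      deg (E C) v + deg (E P) v + χ ⁅ x ⁆ v + χ ⁅ y ⁆ v   ≡⟨ regroup (deg (E C) v) (deg (E P) v) (χ ⁅ x ⁆ v) (χ ⁅ y ⁆ v) ⟩
      deg (E C) v + (deg (E P) v + χ ⁅ y ⁆ v + χ ⁅ x ⁆ v) ≡⟨ cong₂ _+_ (cycle-deg {C} cycle v) (isPath-deg path v) ⟩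
      2 * χ (V C) v + 2 * χ (V P) v                       ≡⟨ *-distribˡ-+ 2 (χ (V C) v) (χ (V P) v) ⟨
      2 * (χ (V C) v + χ (V P) v)                         ≡⟨ cong (2 *_) (χ-∪∩ (V C) (V P) v) ⟨
      2 * (χ (V C ∪ V P) v + χ (V C ∩ V P) v)             ≡⟨ cong (λ m → 2 * (χ (V C ∪ V P) v + χ m v)) V-meet ⟩
      2 * (χ (V C ∪ V P) v + χ ⁅ y ⁆ v)                   ≡⟨ double (χ (V C ∪ V P) v) (χ ⁅ y ⁆ v) ⟩
      2 * χ (V C ∪ V P) v + χ ⁅ y ⁆ v + χ ⁅ y ⁆ v         ∎)
    where
    open IsLollipop l
    open ≡-Reasoning
    regroup : ∀ c p a b → c + p + a + b ≡ c + (p + b + a)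
    regroup = solve-∀
    double : ∀ a b → 2 * (a + b) ≡ 2 * a + b + b
    double = solve-∀

  private
    -- On a cycle, and off the ends of a path, the degree is twice an indicator; parity then
    -- excludes the value 1.
    2*≢1 : ∀ n → 2 * n ≢ 1
    2*≢1 zero ()
    2*≢1 (suc n) eq rewrite +-suc n (n + 0) with () ← eq

  End : Subgraph G → Vertex → Set
  End P v = deg (E P) v ≡ 1

  path-end : ∀ {P x y} → IsPath {G} P x y → ∀ v → v ∈ ⁅ x ⁆ ∪ ⁅ y ⁆ ⇔ End P v
  path-end {P} {x} {y} p v = mk⇔ (to ∘ x∈p∪q⁻ ⁅ x ⁆ ⁅ y ⁆) from
    where
    q = isPath⇒path p
    x≢y = isPath⇒≢ p
    to : v ∈ ⁅ x ⁆ ⊎ v ∈ ⁅ y ⁆ → End P v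
    to (inj₁ v∈) with refl ← x∈⁅y⁆⇒x≡y x v∈ | eq ← path-deg q v
      rewrite χ-≡ x | χ-≢ x≢y | χ-∈ (source∈ q) = +-cancelʳ-≡ 1 _ 1 (trans (sym (+-identityʳ _)) eq)
    to (inj₂ v∈) with refl ← x∈⁅y⁆⇒x≡y y v∈ | eq ← path-deg q v
      rewrite χ-≡ y | χ-≢ (x≢y ∘ sym) | χ-∈ (target∈ q) = +-cancelʳ-≡ 1 _ 1 (trans (cong (_+ 1) (sym (+-identityʳ _))) eq)
    from : End P v → v ∈ ⁅ x ⁆ ∪ ⁅ y ⁆
    from end with v ∈? ⁅ x ⁆ | v ∈? ⁅ y ⁆
    ... | yes v∈ | _      = x∈p∪q⁺ (inj₁ v∈)
    ... | no _   | yes v∈ = x∈p∪q⁺ (inj₂ v∈)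
    ... | no v≢x | no v≢y with eq ← path-deg q v
      rewrite end | χ-∉ v≢x | χ-∉ v≢y = contradiction (sym eq) (2*≢1 (χ (V P) v))

  cycle-end : ∀ {C v} → IsCycle {G} C → ¬ End C v
  cycle-end {C} {v} c end = 2*≢1 (χ (V C) v) (trans (sym (cycle-deg {C} c v)) end)

  lollipop-end : ∀ {Q x} → IsLollipop {G} Q x → ∀ v → v ∈ ⁅ x ⁆ ⇔ End Q v
  lollipop-end {Q} {x} l v = mk⇔ to from
    where
    open IsLollipop l
    VQ≡ = proj₁ glued
    y∈Q : y ∈ V Q
    y∈Q = subst (y ∈_) (sym VQ≡) (q⊆p∪q (V C) (V P) (source∈ (isPath⇒path path)))
    x∈Q : x ∈ V Q
    x∈Q = subst (x ∈_) (sym VQ≡) (q⊆p∪q (V C) (V P) (target∈ (isPath⇒path path)))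
    to : v ∈ ⁅ x ⁆ → End Q v
    to v∈ with refl ← x∈⁅y⁆⇒x≡y x v∈ | eq ← lollipop-deg l v
      rewrite χ-≡ x | χ-≢ (lollipop-≢ l) | χ-∈ x∈Q = +-cancelʳ-≡ 1 _ 1 eq
    from : End Q v → v ∈ ⁅ x ⁆
    from end with v ∈? ⁅ x ⁆ | v ≟ y
    ... | yes v∈ | _ = v∈
    -- The degree at the junction is odd, so parity does not help here; it is excluded because it
    -- equals 3.
    ... | no v≢x | yes refl with eq ← lollipop-deg l v
      rewrite end | χ-∉ v≢x | χ-≡ y | χ-∈ y∈Q with () ← eq
    from end | no v≢x | no v≢y with eq ← lollipop-deg l v
      rewrite end | χ-∉ v≢x | χ-≢ v≢y | +-identityʳ (2 * χ (V Q) v) = contradiction (sym eq) (2*≢1 (χ (V Q) v))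

  -- One reading of `P` with the meeting condition for that reading only; `attached⇒extension`
  -- supplies the conditions for all the others.
  data Attached (H P : Subgraph G) : Set where
    by-path     : ∀ {x y} → IsPath P x y → V H ∩ V P ≡ ⁅ x ⁆ ∪ ⁅ y ⁆ → Attached H P
    by-cycle    : IsCycle P → ∣ V H ∩ V P ∣ ≡ 1 → Attached H P
    by-lollipop : ∀ {x} → IsLollipop P x → V H ∩ V P ≡ ⁅ x ⁆ → Attached H P

  extension⇒attached : ∀ {H P K} → IsExtension H P K → Attached H P
  extension⇒attached x with IsExtension.shape x
  ... | inj₁ (a , b , p)       = by-path p (IsExtension.path-meet x a b p)
  ... | inj₂ (inj₁ c)          = by-cycle c (IsExtension.cycle-meet x c)
  ... | inj₂ (inj₂ (a , l))    = by-lollipop l (IsExtension.lollipop-meet x a l)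

  private
    same-ends : ∀ {P} {A B : Subset (#V G)} → (∀ v → v ∈ A ⇔ End P v) → (∀ v → v ∈ B ⇔ End P v) → A ≡ B
    same-ends a b = ⇔⇒≡ λ v → mk⇔ (Equivalence.from (b v) ∘ Equivalence.to (a v)) (Equivalence.from (a v) ∘ Equivalence.to (b v))

  -- Paths, cycles and lollipops, as well as the ends of a path or a lollipop, are told apart
  -- by the vertices of degree 1.
  attached⇒extension : ∀ {H P} → E P ∩ E H ≡ ⊥ → Attached H P → IsExtension H P (H ⊔ P)
  attached⇒extension {H} {P} disj at = record
    { union         = refl , refl
    ; edge-disjoint = disj
    ; shape         = shape at
    ; path-meet     = path-meet at
    ; lollipop-meet = lollipop-meet at
    ; cycle-meet    = cycle-meet at
    }
    where
    shape : Attached H P → _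
    shape (by-path p _)     = inj₁ (_ , _ , p)
    shape (by-cycle c _)    = inj₂ (inj₁ c)
    shape (by-lollipop l _) = inj₂ (inj₂ (_ , l))
    path-meet : Attached H P → ∀ x y → IsPath P x y → V H ∩ V P ≡ ⁅ x ⁆ ∪ ⁅ y ⁆
    path-meet (by-path p m)     x y q = trans m (same-ends {P} (path-end p) (path-end q))
    path-meet (by-cycle c _)    x y q = contradiction (Equivalence.to (path-end q x) (p⊆p∪q _ (x∈⁅x⁆ x))) (cycle-end {P} c)
    path-meet (by-lollipop l m) x y q = trans m (same-ends {P} (lollipop-end l) (path-end q))
    lollipop-meet : Attached H P → ∀ x → IsLollipop P x → V H ∩ V P ≡ ⁅ x ⁆
    lollipop-meet (by-path p m)     x q = trans m (same-ends {P} (path-end p) (lollipop-end q))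
    lollipop-meet (by-cycle c _)    x q = contradiction (Equivalence.to (lollipop-end q x) (x∈⁅x⁆ x)) (cycle-end {P} c)
    lollipop-meet (by-lollipop l m) x q = trans m (same-ends {P} (lollipop-end l) (lollipop-end q))
    cycle-meet : Attached H P → IsCycle P → ∣ V H ∩ V P ∣ ≡ 1
    cycle-meet (by-path {x} p _)     c = contradiction (Equivalence.to (path-end p x) (p⊆p∪q _ (x∈⁅x⁆ x))) (cycle-end {P} c)
    cycle-meet (by-cycle _ m)        c = m
    cycle-meet (by-lollipop {x} l _) c = contradiction (Equivalence.to (lollipop-end l x) (x∈⁅x⁆ x)) (cycle-end {P} c)

  cycle-card : ∀ {C} → IsCycle {G} C → ∣ E C ∣ ≡ ∣ V C ∣
  cycle-card {C} c = *-cancelˡ-≡ _ _ 2 (begin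
    2 * ∣ E C ∣                        ≡⟨ handshake (E C) ⟨
    ∑[ v < #V G ] deg (E C) v          ≡⟨ sum-cong-≗ (cycle-deg {C} c) ⟩
    ∑[ v < #V G ] (2 * χ (V C) v)      ≡⟨ *-distribˡ-sum 2 (χ (V C)) ⟨
    2 * ∑[ v < #V G ] χ (V C) v        ≡⟨ cong (2 *_) (∣∣≡∑χ (V C)) ⟨
    2 * ∣ V C ∣                        ∎)
    where open ≡-Reasoning

  lollipop-card : ∀ {Q x} → IsLollipop {G} Q x → ∣ E Q ∣ ≡ ∣ V Q ∣
  lollipop-card {Q} l rewrite proj₁ (IsLollipop.glued l) | proj₂ (IsLollipop.glued l) = +-cancelʳ-≡ 1 _ _ (begin
    ∣ E C ∪ E P ∣ + 1             ≡⟨ cong (_+ 1) (∣⊎∣ (∩≡⊥⇒Disjoint E-meet)) ⟩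
    ∣ E C ∣ + ∣ E P ∣ + 1         ≡⟨ trans (+-assoc ∣ E C ∣ _ 1) (cong (∣ E C ∣ +_) (+-comm _ 1)) ⟩
    ∣ E C ∣ + suc ∣ E P ∣         ≡⟨ cong₂ _+_ (cycle-card {C} cycle) (path-card (isPath⇒path path)) ⟩
    ∣ V C ∣ + ∣ V P ∣             ≡⟨ ∣∪∣+∣∩∣ (V C) (V P) ⟨
    ∣ V C ∪ V P ∣ + ∣ V C ∩ V P ∣ ≡⟨ cong (∣ V C ∪ V P ∣ +_) (trans (cong ∣_∣ V-meet) (∣⁅x⁆∣≡1 y)) ⟩
    ∣ V C ∪ V P ∣ + 1             ∎)
    where
    open IsLollipop l
    open ≡-Reasoning

  -- A path has one vertex more than edges but meets `H` twice; a cycle or a lollipop has as many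
  -- edges as vertices and meets `H` once.
  attached-card : ∀ {H P} → Attached H P → ∣ E P ∣ + ∣ V H ∩ V P ∣ ≡ suc ∣ V P ∣
  attached-card {H} {P} (by-path {x} {y} p m) = begin
    ∣ E P ∣ + ∣ V H ∩ V P ∣     ≡⟨ cong (λ S → ∣ E P ∣ + ∣ S ∣) m ⟩
    ∣ E P ∣ + ∣ ⁅ x ⁆ ∪ ⁅ y ⁆ ∣ ≡⟨ cong (∣ E P ∣ +_) (trans (∣⁅⁆∪∣ (x≢y⇒x∉⁅y⁆ (isPath⇒≢ p))) (cong suc (∣⁅x⁆∣≡1 y))) ⟩
    ∣ E P ∣ + 2                 ≡⟨ +-comm ∣ E P ∣ 2 ⟩
    suc (suc ∣ E P ∣)           ≡⟨ cong suc (path-card (isPath⇒path p)) ⟩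
    suc ∣ V P ∣                 ∎
    where open ≡-Reasoning
  attached-card {P = P} (by-cycle c m) = trans (cong₂ _+_ (cycle-card {P} c) m) (+-comm ∣ V P ∣ 1)
  attached-card {P = P} (by-lollipop {x} l m) =
    trans (cong₂ _+_ (lollipop-card l) (trans (cong ∣_∣ m) (∣⁅x⁆∣≡1 x))) (+-comm ∣ V P ∣ 1)

  -- The equation for `Δ` with its negative terms moved across, so that the counting stays in ℕ.
  -- Adding `∣ V H ∩ V P ∣` to both sides makes inclusion-exclusion and `attached-card` applicable.
  extension-card : ∀ {H P K} → IsExtension {G} H P K → ∣ E K ∣ + ∣ V H ∣ ≡ suc (∣ E H ∣ + ∣ V K ∣)
  extension-card {H} {P} x rewrite proj₁ (IsExtension.union x) | proj₂ (IsExtension.union x) = +-cancelʳ-≡ ∣ V H ∩ V P ∣ _ _ (begin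
    ∣ E H ∪ E P ∣ + ∣ V H ∣ + ∣ V H ∩ V P ∣         ≡⟨ cong (λ z → z + ∣ V H ∣ + ∣ V H ∩ V P ∣) (∣⊎∣ disj) ⟩
    ∣ E H ∣ + ∣ E P ∣ + ∣ V H ∣ + ∣ V H ∩ V P ∣     ≡⟨ regroup (∣ E H ∣) (∣ E P ∣) (∣ V H ∣) (∣ V H ∩ V P ∣) ⟩
    ∣ E H ∣ + ∣ V H ∣ + (∣ E P ∣ + ∣ V H ∩ V P ∣)   ≡⟨ cong (∣ E H ∣ + ∣ V H ∣ +_) (attached-card (extension⇒attached x)) ⟩
    ∣ E H ∣ + ∣ V H ∣ + suc ∣ V P ∣                 ≡⟨ regroup′ (∣ E H ∣) (∣ V H ∣) (∣ V P ∣) ⟩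
    suc (∣ E H ∣ + (∣ V H ∣ + ∣ V P ∣))             ≡⟨ cong (λ z → suc (∣ E H ∣ + z)) (∣∪∣+∣∩∣ (V H) (V P)) ⟨
    suc (∣ E H ∣ + (∣ V H ∪ V P ∣ + ∣ V H ∩ V P ∣)) ≡⟨ cong suc (+-assoc ∣ E H ∣ _ _) ⟨
    suc (∣ E H ∣ + ∣ V H ∪ V P ∣) + ∣ V H ∩ V P ∣   ∎)
    where
    open ≡-Reasoning
    disj : Disjoint (E H) (E P)
    disj e∈H e∈P = ∩≡⊥⇒Disjoint (IsExtension.edge-disjoint x) e∈P e∈H
    regroup : ∀ a b c d → a + b + c + d ≡ a + c + (b + d)
    regroup = solve-∀
    regroup′ : ∀ a b c → a + b + suc c ≡ suc (a + (b + c))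
    regroup′ = solve-∀

  extension-Δ : ∀ {H P K} → IsExtension {G} H P K → Δ K - Δ H ≡ 1ℤ
  extension-Δ {H} {P} {K} x = begin
    (pos ∣ E K ∣ - pos ∣ V K ∣) - (pos ∣ E H ∣ - pos ∣ V H ∣) ≡⟨ regroup (pos ∣ E K ∣) (pos ∣ V K ∣) (pos ∣ E H ∣) (pos ∣ V H ∣) ⟩
    pos (∣ E K ∣ + ∣ V H ∣) - pos (∣ E H ∣ + ∣ V K ∣)         ≡⟨ cong (λ z → pos z - pos (∣ E H ∣ + ∣ V K ∣)) (extension-card x) ⟩
    pos (suc (∣ E H ∣ + ∣ V K ∣)) - pos (∣ E H ∣ + ∣ V K ∣)   ≡⟨ cancel (pos (∣ E H ∣ + ∣ V K ∣)) ⟩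
    1ℤ                                                        ∎
    where
    open ≡-Reasoning
    regroup : ∀ a b c d → (a - b) - (c - d) ≡ (a +ℤ d) - (c +ℤ b)
    regroup = ℤ-solve.solve-∀
    cancel : ∀ a → (1ℤ +ℤ a) - a ≡ 1ℤ
    cancel = ℤ-solve.solve-∀

  -- Properness comes from `Δ`: equal subgraphs would have difference 0 and not 1.
  extension-⊏ : ∀ {H P K} → IsExtension {G} H P K → H ⊏ K
  extension-⊏ {H} {P} {K} x = (subst (_ ∈_) (sym VK) ∘ p⊆p∪q (V P) , subst (_ ∈_) (sym EK) ∘ p⊆p∪q (E P)) , λ (V≡ , E≡) →
    contradiction (trans (sym (ℤ.+-inverseʳ (Δ K))) (trans (cong₂ (λ e v → Δ K - (pos ∣ e ∣ - pos ∣ v ∣)) (sym E≡) (sym V≡)) (extension-Δ x))) λ ()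
    where
    VK = proj₁ (IsExtension.union x)
    EK = proj₂ (IsExtension.union x)

-- Cores, probes and the construction of ears

module Decompositions (G : Graph) where

  open Ears G public

  incident? : ∀ e v → Dec (Incident {G} e v)
  incident? e v = (source G e ≟ v) ⊎-dec (target G e ≟ v)

  other-end : ∀ {e v} → Incident {G} e v → ∃[ w ] Joins {G} e v w
  other-end {e} (inj₁ s≡v) = target G e , inj₁ (s≡v , refl)
  other-end {e} (inj₂ t≡v) = source G e , inj₂ (refl , t≡v)

  Joins-incident : ∀ {e u v} → Joins {G} e u v → Incident {G} e v
  Joins-incident (inj₁ (_ , t≡v)) = inj₂ t≡v
  Joins-incident (inj₂ (s≡v , _)) = inj₁ s≡v

  Joins-loop : ∀ {e u v} → Joins {G} e u v → IsLoop {G} e → u ≡ v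
  Joins-loop (inj₁ (refl , refl)) loop = loop
  Joins-loop (inj₂ (refl , refl)) loop = sym loop

  another-edge : (H : Subgraph G) {v : Vertex} {e : Edge} → ¬ Leaf H v → v ∈ V H → e ∈ E H → Incident {G} e v → ¬ IsLoop {G} e →
    ∃[ f ] f ∈ E H × Incident {G} f v × f ≢ e
  another-edge H {v} {e} ¬leaf v∈ e∈ inc-e ¬loop with any? (λ f → (f ∈? E H) ×-dec (incident? f v) ×-dec ¬? (f ≟ e))
  ... | yes found = found
  ... | no none   = contradiction
    (v∈ , e , e∈ , inc-e , ¬loop , λ {f} f∈ inc-f → decidable-stable (f ≟ e) λ f≢e → none (f , f∈ , inc-f , f≢e)) ¬leaf

  -- The invariant of the construction. It covers both admissible kinds of `G₀`: a cycle satisfies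
  -- it without being a cactus.
  Core : Subgraph G → Set
  Core H = Connected H × (∀ {v} → v ∈ V H → 2 ≤ deg (E H) v)

  cycle⇒core : ∀ {H} → IsCycle {G} H → Core H
  cycle⇒core {H} (conn , two) = conn , λ {v} v∈ → ≤-reflexive (trans (sym (two v∈)) (degree≡deg H v))

  -- Some edge is incident to `v`, which is not isolated. A loop contributes 2 by itself; otherwise
  -- the absence of leaves yields a second edge, and both are split off from the degree sum.
  cactus⇒core : ∀ {H} → IsCactus {G} H → Core H
  cactus⇒core {H} (conn , ¬isolated , ¬leaf , _) = conn , two
    where
    two : ∀ {v} → v ∈ V H → 2 ≤ deg (E H) v
    two {v} v∈ with any? (λ e → (e ∈? E H) ×-dec incident? e v)
    ... | no none = contradiction (v∈ , λ {e} e∈ inc-e → none (e , e∈ , inc-e)) (¬isolated v)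
    ... | yes (e , e∈ , inc-e) with source G e ≟ target G e
    ...   | no ¬loop = let f , f∈ , inc-f , f≢e = another-edge H (¬leaf v) v∈ e∈ inc-e ¬loop in begin
      2                                          ≤⟨ +-mono-≤ (Incident⇒1≤inc inc-e) (Incident⇒1≤inc inc-f) ⟩
      inc e v + inc f v                          ≤⟨ m≤m+n _ _ ⟩
      inc e v + inc f v + deg (E H ∖ e ∖ f) v    ≡⟨ +-assoc (inc e v) _ _ ⟩
      inc e v + (inc f v + deg (E H ∖ e ∖ f) v)  ≡⟨ cong (inc e v +_) (deg-remove (x∈p∧x≢y⇒x∈p-y f∈ f≢e) v) ⟨
      inc e v + deg (E H ∖ e) v                  ≡⟨ deg-remove e∈ v ⟨
      deg (E H) v                                ∎
      where open ≤-Reasoning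
    ...   | yes loop = begin
      2                          ≡⟨ inc≡2 inc-e ⟨
      inc e v                    ≤⟨ m≤m+n _ _ ⟩
      inc e v + deg (E H ∖ e) v  ≡⟨ deg-remove e∈ v ⟨
      deg (E H) v                ∎
      where
      open ≤-Reasoning
      inc≡2 : Incident {G} e v → inc e v ≡ 2
      inc≡2 (inj₁ refl) rewrite sym loop | χ-≡ (source G e) = refl
      inc≡2 (inj₂ refl) rewrite loop | χ-≡ (target G e) = refl

  -- As `H` is connected, maximality applied to `H` makes every component all of `H`; a component
  -- that is a cycle would give `b` degree 2.
  core⇒cactus : ∀ {H b} → Core H → b ∈ V H → 3 ≤ deg (E H) b → IsCactus {G} H
  core⇒cactus {H} {b} (conn , two) b∈ 3≤deg = conn , ¬isolated , ¬leaf , ¬cycle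
    where
    ¬isolated : ∀ v → ¬ Isolated H v
    ¬isolated v (v∈ , none) with () ← ≤-trans (two v∈) (≤-reflexive (deg-unincident {E H} none))
    ¬leaf : ∀ v → ¬ Leaf H v
    ¬leaf v (v∈ , e , e∈ , inc-e , ¬loop , unique) = contradiction (begin
      2                          ≤⟨ two v∈ ⟩
      deg (E H) v                ≡⟨ deg-remove e∈ v ⟩
      inc e v + deg (E H ∖ e) v  ≡⟨ cong₂ _+_ (inc≡1 inc-e) (deg-unincident {E H ∖ e} none) ⟩
      1                          ∎) λ { (s≤s ()) }
      where
      open ≤-Reasoning
      inc≡1 : Incident {G} e v → inc e v ≡ 1
      inc≡1 (inj₁ refl) rewrite χ-≡ (source G e) | χ-≢ ¬loop = refl
      inc≡1 (inj₂ refl) rewrite χ-≡ (target G e) | χ-≢ (¬loop ∘ sym) = refl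
      none : ∀ {f} → f ∈ E H ∖ e → ¬ Incident {G} f v
      none {f} f∈ inc-f = x∉p∖x (E H) e (subst (_∈ E H ∖ e) (unique (p─q⊆p (E H) ⁅ e ⁆ f∈) inc-f) f∈)
    ¬cycle : ∀ K → IsComponent K H → ¬ IsCycle K
    ¬cycle K ((V⊆ , E⊆) , _ , maximal) cyc
      with V⊇ , E⊇ ← maximal H (V⊆ , E⊆) ((λ v∈ → v∈) , (λ e∈ → e∈)) conn
      with s≤s (s≤s ()) ← ≤-trans 3≤deg (≤-reflexive (trans (cong (λ F → deg F b) (⊆-antisym E⊇ E⊆))
                                                      (trans (cycle-deg {K} cyc b) (cong (2 *_) (χ-∈ (V⊇ b∈))))))

  -- The ends of `f` supply exactly the two indicators in `path-deg`. The case `x ≡ y` is included: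
  -- `f` is then a loop added to the empty path.
  closing-edge-cycle : (C : Subgraph G) → ∀ {x y S F f} → Path x y S F → V C ≡ S → E C ≡ ⁅ f ⁆ ∪ F → f ∉ F → Joins {G} f x y → IsCycle C
  closing-edge-cycle C {x} {y} {S} {F} {f} p V≡ E≡ f∉F j =
    connected-via C {y} (subst (y ∈_) (sym V≡) (target∈ p))
      (λ v∈ → Adj-mono (λ e∈ → subst (_ ∈_) (sym E≡) (q⊆p∪q ⁅ f ⁆ F e∈)) (path-connected p (subst (_ ∈_) V≡ v∈)))
    , two
    where
    two : ∀ {v} → v ∈ V C → degree C v ≡ 2
    two {v} v∈ rewrite degree≡deg C v | E≡ | deg-⁅⁆∪ f∉F v | Joins-inc j v = begin
      χ ⁅ x ⁆ v + χ ⁅ y ⁆ v + deg F v   ≡⟨ trans (+-comm _ (deg F v)) (sym (+-assoc (deg F v) _ _)) ⟩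
      deg F v + χ ⁅ x ⁆ v + χ ⁅ y ⁆ v   ≡⟨ path-deg p v ⟩
      2 * χ S v                         ≡⟨ cong (2 *_) (χ-∈ (subst (v ∈_) V≡ v∈)) ⟩
      2                                 ∎
      where open ≡-Reasoning

  record Ear (H : Subgraph G) : Set where
    field
      P         : Subgraph G
      extension : IsExtension H P (H ⊔ P)
      grows     : E (H ⊔ P) ⊃ E H
      cactus    : IsCactus (H ⊔ P)

  -- A path leaving H at b is stored backwards, so that a new tip is added at its front.
  record Probe (H : Subgraph G) (b t w : Vertex) (S : Subset (#V G)) (F : Subset (#E G)) (f : Edge) : Set where
    field
      path    : Path t b S F
      b∈H     : b ∈ V H
      off     : ∀ {v} → v ∈ S → v ∈ V H → v ≡ b
      F-new   : Disjoint F (E H)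
      f-new   : f ∉ E H
      f-fresh : f ∉ F
      joins   : Joins {G} f t w

  module _ {H : Subgraph G} (core : Core H) {b t w S F f} (probe : Probe H b t w S F f) where

    open Probe probe

    private
      -- One subgraph for all three outcomes: if the walk has met itself, `w` is already in `S` and
      -- adding it changes nothing.
      P : Subgraph G
      P = record { V = ⁅ w ⁆ ∪ S ; E = ⁅ f ⁆ ∪ F ; closed = closed-P ∘′ x∈p∪q⁻ ⁅ f ⁆ F }
        where
        closed-P : ∀ {e} → e ∈ ⁅ f ⁆ ⊎ e ∈ F → source G e ∈ ⁅ w ⁆ ∪ S × target G e ∈ ⁅ w ⁆ ∪ S
        closed-P (inj₁ e≡f) rewrite x∈⁅y⁆⇒x≡y f e≡f =
          Joins-ends joins (q⊆p∪q ⁅ w ⁆ S (source∈ path)) (p⊆p∪q S (x∈⁅x⁆ w))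
        closed-P (inj₂ e∈F) = let s∈ , t∈ = path-closed path e∈F in q⊆p∪q ⁅ w ⁆ S s∈ , q⊆p∪q ⁅ w ⁆ S t∈

      P-new : Disjoint (E P) (E H)
      P-new e∈ e∈H = [ (λ e≡f → f-new (subst (_∈ E H) (x∈⁅y⁆⇒x≡y f e≡f) e∈H)) , (λ e∈F → F-new e∈F e∈H) ]′ (x∈p∪q⁻ ⁅ f ⁆ F e∈)

      b∈P : b ∈ V P
      b∈P = q⊆p∪q ⁅ w ⁆ S (target∈ path)

      V-P : w ∈ S → V P ≡ S
      V-P = ⊆⇒∪≡ ∘ ⁅⁆⊆

      meet-b : w ∈ S → V H ∩ V P ≡ ⁅ b ⁆
      meet-b w∈S = ⇔⇒≡ λ v → mk⇔
        (λ v∈ → let v∈H , v∈P = x∈p∩q⁻ (V H) (V P) v∈ in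
          subst (_∈ ⁅ b ⁆) (sym (off (subst (v ∈_) (V-P w∈S) v∈P) v∈H)) (x∈⁅x⁆ b))
        (⁅⁆⊆ (x∈p∩q⁺ (b∈H , b∈P)))

      meet-bw : w ∈ V H → V H ∩ V P ≡ ⁅ w ⁆ ∪ ⁅ b ⁆
      meet-bw w∈H = ⇔⇒≡ λ v → mk⇔
        (λ v∈ → let v∈H , v∈P = x∈p∩q⁻ (V H) (V P) v∈ in
          x∈p∪q⁺ (Sum.map id (λ v∈S → subst (_∈ ⁅ b ⁆) (sym (off v∈S v∈H)) (x∈⁅x⁆ b)) (x∈p∪q⁻ ⁅ w ⁆ S v∈P)))
        ([ ⁅⁆⊆ (x∈p∩q⁺ (w∈H , p⊆p∪q S (x∈⁅x⁆ w))) , ⁅⁆⊆ (x∈p∩q⁺ (b∈H , b∈P)) ]′ ∘′ x∈p∪q⁻ ⁅ w ⁆ ⁅ b ⁆)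

      attached-back : w ∈ S → Attached H P
      attached-back w∈S with w ≟ b
      ... | yes refl = by-cycle (closing-edge-cycle P path (V-P w∈S) refl f-fresh joins) (trans (cong ∣_∣ (meet-b w∈S)) (∣⁅x⁆∣≡1 b))
      ... | no w≢b = by-lollipop lollipop (meet-b w∈S)
        where
        -- The path is stored from the tip `t` back to `b`: `before`, from `t` to `w`, is closed to
        -- a cycle by `f`, and `after`, from `w` to `b`, is the stick.
        open Split (split path w∈S)
        f∉F₁ : f ∉ F₁
        f∉F₁ f∈ = f-fresh (subst (f ∈_) (sym F-union) (p⊆p∪q F₂ f∈))
        C P₂ : Subgraph G
        C = record { V = S₁ ; E = ⁅ f ⁆ ∪ F₁ ; closed = closed-C ∘′ x∈p∪q⁻ ⁅ f ⁆ F₁ }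
          where
          closed-C : ∀ {e} → e ∈ ⁅ f ⁆ ⊎ e ∈ F₁ → source G e ∈ S₁ × target G e ∈ S₁
          closed-C (inj₁ e≡f) rewrite x∈⁅y⁆⇒x≡y f e≡f = Joins-ends joins (source∈ before) (target∈ before)
          closed-C (inj₂ e∈) = path-closed before e∈
        P₂ = record { V = S₂ ; E = F₂ ; closed = path-closed after }
        lollipop : IsLollipop P b
        lollipop = record
          { C = C ; P = P₂ ; y = w
          ; cycle  = closing-edge-cycle C before refl refl f∉F₁ joins
          ; path   = path⇒isPath after w≢b
          ; V-meet = ⇔⇒≡ λ v → mk⇔
              (λ v∈ → let v∈₁ , v∈₂ = x∈p∩q⁻ S₁ S₂ v∈ in subst (_∈ ⁅ w ⁆) (sym (S-meet v∈₁ v∈₂)) (x∈⁅x⁆ w))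
              (⁅⁆⊆ (x∈p∩q⁺ (target∈ before , source∈ after)))
          ; E-meet = Disjoint⇒∩≡⊥ λ e∈ e∈₂ →
              [ (λ e≡f → f-fresh (subst (f ∈_) (sym F-union) (q⊆p∪q F₁ F₂ (subst (_∈ F₂) (x∈⁅y⁆⇒x≡y f e≡f) e∈₂))))
              , (λ e∈₁ → F-meet e∈₁ e∈₂) ]′ (x∈p∪q⁻ ⁅ f ⁆ F₁ e∈)
          ; glued  = trans (V-P w∈S) S-union
                   , trans (cong (⁅ f ⁆ ∪_) F-union) (sym (∪-assoc ⁅ f ⁆ F₁ F₂))
          }

      attached : w ∈ S ⊎ w ∈ V H → Attached H P
      attached back with w ∈? S
      -- Membership in `S` is decided first: `w` may be `b`, which lies in both `S` and `V H`, and
      -- `P` is then a cycle and not a path.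
      attached back       | yes w∈S = attached-back w∈S
      attached (inj₁ w∈S) | no w∉S  = contradiction w∈S w∉S
      attached (inj₂ w∈H) | no w∉S  = by-path
        (path⇒isPath (step (Joins-sym joins) w∉S path) λ w≡b → w∉S (subst (_∈ S) (sym w≡b) (target∈ path)))
        (meet-bw w∈H)

      -- Valid for the three shapes at once: it gives degree at least 2 on `S` away from `b`, and at
      -- least 1 at `b`.
      P-deg : ∀ v → deg (E P) v + χ ⁅ b ⁆ v ≡ 2 * χ S v + χ ⁅ w ⁆ v
      P-deg v rewrite deg-⁅⁆∪ f-fresh v | Joins-inc joins v = begin
        χ ⁅ t ⁆ v + χ ⁅ w ⁆ v + deg F v + χ ⁅ b ⁆ v   ≡⟨ regroup (χ ⁅ t ⁆ v) (χ ⁅ w ⁆ v) (deg F v) (χ ⁅ b ⁆ v) ⟩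
        deg F v + χ ⁅ t ⁆ v + χ ⁅ b ⁆ v + χ ⁅ w ⁆ v   ≡⟨ cong (_+ χ ⁅ w ⁆ v) (path-deg path v) ⟩
        2 * χ S v + χ ⁅ w ⁆ v                         ∎
        where
        open ≡-Reasoning
        regroup : ∀ t w d b → t + w + d + b ≡ d + t + b + w
        regroup = solve-∀

      K : Subgraph G
      K = H ⊔ P

      K-deg : ∀ v → deg (E K) v ≡ deg (E H) v + deg (E P) v
      K-deg = deg-⊎ λ e∈H e∈P → P-new e∈P e∈H

      module _ (back : w ∈ S ⊎ w ∈ V H) where

        V-K : ∀ {v} → v ∈ V K → v ∈ V H ⊎ v ∈ S
        V-K v∈ with x∈p∪q⁻ (V H) (V P) v∈
        ... | inj₁ v∈H = inj₁ v∈H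
        ... | inj₂ v∈P with x∈p∪q⁻ ⁅ w ⁆ S v∈P
        ...   | inj₂ v∈S = inj₂ v∈S
        ...   | inj₁ v≡w rewrite x∈⁅y⁆⇒x≡y w v≡w = Sum.swap back

        K-connected : Connected K
        K-connected = connected-via K {b} (p⊆p∪q (V P) b∈H) λ v∈ →
          [ (λ v∈H → Adj-mono (p⊆p∪q (E P)) (proj₂ (proj₁ core) v∈H b∈H))
          , (λ v∈S → Adj-mono (q⊆p∪q (E H) (E P) ∘ q⊆p∪q ⁅ f ⁆ F) (path-connected path v∈S)) ]′ (V-K v∈)

        K-core : Core K
        K-core = K-connected , two
          where
          two : ∀ {v} → v ∈ V K → 2 ≤ deg (E K) v
          two {v} v∈ with v ∈? V H
          ... | yes v∈H rewrite K-deg v = ≤-trans (proj₂ core v∈H) (m≤m+n _ _)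
          ... | no v∉H with V-K v∈
          ...   | inj₁ v∈H = contradiction v∈H v∉H
          ...   | inj₂ v∈S = begin
            2                          ≤⟨ m≤m+n 2 _ ⟩
            2 * 1 + χ ⁅ w ⁆ v          ≡⟨ cong (λ m → 2 * m + χ ⁅ w ⁆ v) (χ-∈ v∈S) ⟨
            2 * χ S v + χ ⁅ w ⁆ v      ≡⟨ P-deg v ⟨
            deg (E P) v + χ ⁅ b ⁆ v    ≡⟨ cong (deg (E P) v +_) (χ-≢ λ v≡b → v∉H (subst (_∈ V H) (sym v≡b) b∈H)) ⟩
            deg (E P) v + 0            ≡⟨ +-identityʳ _ ⟩
            deg (E P) v                ≤⟨ m≤n+m _ _ ⟩
            deg (E H) v + deg (E P) v  ≡⟨ K-deg v ⟨
            deg (E K) v                ∎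
            where open ≤-Reasoning

        b-deg : 3 ≤ deg (E K) b
        -- Cancelling 1 in `P-deg` at `b` leaves `deg (E P) b ≡ 1 + χ ⁅ w ⁆ b`, which comes on top
        -- of degree at least 2 in `H`.
        b-deg with eq ← P-deg b rewrite K-deg b | χ-≡ b | χ-∈ (target∈ path) | +-comm (deg (⁅ f ⁆ ∪ F) b) 1 | suc-injective eq
          = +-mono-≤ (proj₂ core b∈H) (s≤s z≤n)

    close : w ∈ S ⊎ w ∈ V H → Ear H
    close back = record
      { P         = P
      ; extension = attached⇒extension (Disjoint⇒∩≡⊥ P-new) (attached back)
      ; grows     = p⊆p∪q (E P) , f , q⊆p∪q (E H) (E P) (p⊆p∪q F (x∈⁅x⁆ f)) , f-new
      ; cactus    = core⇒cactus {K} (K-core back) (p⊆p∪q (V P) b∈H) (b-deg back)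
      }

    extend : (∀ v → ¬ Leaf (whole G) v) → w ∉ S → w ∉ V H → ∃[ f′ ] ∃[ w′ ] Probe H b w w′ (⁅ w ⁆ ∪ S) (⁅ f ⁆ ∪ F) f′
    -- The tip `t` lies in `S` and `w` does not, so `f` is not a loop and the absence of leaves
    -- gives another edge at `w`.
    extend ¬leaf w∉S w∉H with another-edge (whole G) (¬leaf w) ∈⊤ ∈⊤ (Joins-incident joins)
                                (λ loop → w∉S (subst (_∈ S) (Joins-loop joins loop) (source∈ path)))
    ... | f′ , _ , inc-f′ , f′≢f with other-end inc-f′
    ...   | w′ , j = f′ , w′ , record
      { path    = step (Joins-sym joins) w∉S path
      ; b∈H     = b∈H
      ; off     = λ v∈ v∈H → [ (λ v≡w → contradiction (subst (_∈ V H) (x∈⁅y⁆⇒x≡y w v≡w) v∈H) w∉H)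
                             , (λ v∈S → off v∈S v∈H) ]′ (x∈p∪q⁻ ⁅ w ⁆ S v∈)
      ; F-new   = P-new
      ; f-new   = λ f′∈ → w∉H (Joins-end∈ j (closed H f′∈))
      ; f-fresh = [ f′≢f ∘ x∈⁅y⁆⇒x≡y f , fresh-edge path j w∉S ]′ ∘′ x∈p∪q⁻ ⁅ f ⁆ F
      ; joins   = j
      }

  -- The search ends because `S` gains the vertex `w` each time the walk goes on, and `_⊃_` is
  -- well-founded on subsets of a finite set.
  find-ear : (∀ v → ¬ Leaf (whole G) v) → ∀ {H} → Core H → ∀ {b t w S F f} → Acc _⊃_ S → Probe H b t w S F f → Ear H
  find-ear ¬leaf {H} core {w = w} {S} (acc rec) probe with w ∈? S | w ∈? V H
  ... | yes w∈S | _       = close core probe (inj₁ w∈S)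
  ... | no w∉S  | yes w∈H = close core probe (inj₂ w∈H)
  ... | no w∉S  | no w∉H  = let _ , _ , probe′ = extend core probe ¬leaf w∉S w∉H in
    find-ear ¬leaf core (rec (q⊆p∪q ⁅ w ⁆ S , w , p⊆p∪q S (x∈⁅x⁆ w) , w∉S)) probe′

  -- If no edge outside `H` touches `H`, then `H` is closed under walks in `G`, so connectedness
  -- makes it all of `G`. Otherwise such an edge starts a probe on the empty path; it may be a chord
  -- with both ends in `H`.
  whole⊎probe : Connected (whole G) → ∀ {H} → Connected H →
    H ≈ whole G ⊎ ∃[ b ] ∃[ w ] ∃[ f ] Probe H b b w ⁅ b ⁆ ⊥ f
  whole⊎probe G-conn {H} ((b₀ , b₀∈) , _) with any? (λ f → ¬? (f ∈? E H) ×-dec any? (λ b → (b ∈? V H) ×-dec incident? f b))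
  ... | yes (f , f∉ , b , b∈ , inc-f) = let w , j = other-end inc-f in inj₂ (b , w , f , record
      { path    = []
      ; b∈H     = b∈
      ; off     = λ v∈ _ → x∈⁅y⁆⇒x≡y b v∈
      ; F-new   = λ e∈ → contradiction e∈ ∉⊥
      ; f-new   = f∉
      ; f-fresh = ∉⊥
      ; joins   = j
      })
  ... | no none = inj₁ (V≡ , E≡)
    where
    edge∈ : ∀ {e v} → v ∈ V H → Incident {G} e v → e ∈ E H
    edge∈ {e} v∈ inc-e = decidable-stable (e ∈? E H) λ e∉ → none (e , e∉ , _ , v∈ , inc-e)
    reach : ∀ {u v} → u ∈ V H → Star (Adjacent (whole G)) u v → v ∈ V H
    reach u∈ ε = u∈
    reach u∈ ((e , _ , j) ◅ walk) = reach (Joins-end∈ (Joins-sym j) (closed H (edge∈ u∈ (Joins-incident (Joins-sym j))))) walk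
    all-V : ∀ v → v ∈ V H
    all-V v = reach b₀∈ (proj₂ G-conn ∈⊤ ∈⊤)
    V≡ : V H ≡ ⊤
    V≡ = ⊆-antisym ⊆⊤ λ {v} _ → all-V v
    E≡ : E H ≡ ⊤
    E≡ = ⊆-antisym ⊆⊤ λ {e} _ → edge∈ (all-V (source G e)) (inj₁ refl)

  -- Each ear enlarges the edge set, on which the recursion runs. The equality `K zero ≡ H` is
  -- propositional because `≈` ignores the `closed` proofs and does not allow `subst` when the first
  -- ear is prepended.
  decompose : IsCactus (whole G) → ∀ {H} → Acc _⊃_ (E H) → Core H →
    ∃[ r ] ∃[ P ] ∃[ K ] K zero ≡ H × IsDecomposition H r P K
  decompose G-cactus@(G-conn , _ , ¬leaf , _) {H} (acc rec) core with whole⊎probe G-conn (proj₁ core)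
  ... | inj₁ H≈G = 0 , (λ ()) , (λ _ → H) , refl , record
    { starts  = refl , refl
    ; ends    = H≈G
    ; trivial = mk⇔ (λ _ → sym (proj₁ H≈G) , sym (proj₂ H≈G)) (λ _ → refl)
    ; cacti   = λ ()
    ; extends = λ ()
    }
  ... | inj₂ (_ , _ , _ , probe) with find-ear ¬leaf core (⊃-wellFounded _) probe
  ...   | record { P = P₁ ; extension = ext ; grows = grows ; cactus = H₁-cactus }
    with decompose G-cactus (rec grows) (cactus⇒core {H ⊔ P₁} H₁-cactus)
  ...     | r , P , K , K₀≡ , D = suc r , (P₁ ◂ P) , (H ◂ K) , refl , record
    { starts  = refl , refl
    ; ends    = ends
    -- The last component of `grows` says that some edge of the ear is missing from `H`, so `H` is
    -- not all of `G`.
    ; trivial = mk⇔ (λ ()) λ G≈H → contradiction (subst (_ ∈_) (proj₂ G≈H) ∈⊤) (proj₂ (proj₂ (proj₂ grows)))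
    ; cacti   = λ { zero → subst IsCactus (sym K₀≡) H₁-cactus ; (suc i) → cacti i }
    ; extends = λ { zero → subst (IsExtension H P₁) (sym K₀≡) ext ; (suc i) → extends i }
    }
    where open IsDecomposition D

mainTheorem3 : (G : Graph) (G₀ : Subgraph G) →
    Connected (whole G) → Connected G₀ →
    IsCactus (whole G) → IsCactus G₀ ⊎ IsCycle G₀ →
    (∃[ r ] ∃[ P ] ∃[ H ] IsDecomposition G₀ r P H)
    × (∀ r (P : Fin r → Subgraph G) (H : Fin (suc r) → Subgraph G) → IsDecomposition G₀ r P H →
    ∀ i → H (inject₁ i) ⊏ H (suc i) × Δ (H (suc i)) - Δ (H (inject₁ i)) ≡ 1ℤ)
mainTheorem3 G G₀ _ _ G-cactus start =
  (let r , P , H , _ , D = decompose G-cactus (⊃-wellFounded (E G₀)) ([ cactus⇒core {G₀} , cycle⇒core {G₀} ]′ start) in r , P , H , D) ,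
  λ r P H D i → let x = IsDecomposition.extends D i in extension-⊏ x , extension-Δ x
  where open Decompositions G
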